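{- Let $m$ be an odd positive integer. Then for every integer $n\ge 1$, $$\sum_{0\le k<n}F_{mk}^2=\frac{F_{mn}\,F_{m(n-1)}}{L_m}.$$
   Context: $F_n$ denotes the Fibonacci numbers: $F_0=0$, $F_1=1$, $F_n=F_{n-1}+F_{n-2}$. $L_n$ denotes the Lucas numbers: $L_0=2$, $L_1=1$, $L_n=L_{n-1}+L_{n-2}$. -}

module Defs where

open import Data.Nat using (ℕ; zero; suc; _+_; NonZero; _>_; >-nonZero; z≤n; s≤s)
open import Data.Nat.Properties using (<-≤-trans; m≤n+m)

F : ℕ → ℕ
F zero          = 0
F (suc zero)    = 1
F (suc (suc n)) = F (suc n) + F n

L : ℕ → ℕ
L zero          = 2
L (suc zero)    = 1
L (suc (suc n)) = L (suc n) + L n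

L>0 : ∀ n → L n > 0
L>0 zero          = s≤s z≤n
L>0 (suc zero)    = s≤s z≤n
L>0 (suc (suc n)) = <-≤-trans (L>0 n) (m≤n+m (L n) (L (suc n)))

L-nonZero : ∀ n → NonZero (L n)
L-nonZero n = >-nonZero (L>0 n)

{-# OPTIONS --safe #-}

-- For odd m one has F (b + m) * L m = F (b + 2 m) - F b.  Taking b = m (n - 1)
-- and multiplying by F (m n) gives
--   L m * F (m n) ^ 2 = F (m n) * F (m (n + 1)) - F (m n) * F (m (n - 1)),
-- so the sum of squares telescopes.
module Submission where

open import Defs
open import Data.Nat using (ℕ; zero; suc; _+_; _*_; _∸_; _^_; _≤_; NonZero)
open import Data.Nat.Properties using (+-comm; +-suc; +-identityʳ; *-zeroʳ; *-suc; *-distribʳ-+)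
open import Data.Nat.Divisibility using (_∤_; ∣-refl; ∣m∣n⇒∣m+n; _∣0)
open import Data.Nat.ListAction using (sum)
open import Data.Nat.ListAction.Properties using (sum-++)
open import Data.Nat.Tactic.RingSolver using (solve-∀)
open import Data.List using (map; upTo; []; _∷_; _∷ʳ_; _++_)
open import Data.List.Properties using (map-++; upTo-∷ʳ)
open import Data.Integer using (+_)
open import Data.Integer.Properties using (pos-*) renaming (*-identityʳ to ℤ-*-identityʳ)
import Data.Integer as ℤ
open import Data.Product using (∃-syntax; _,_)
open import Data.Rational using (_/_)
open import Data.Rational.Properties using (fromℚᵘ-cong)
open import Data.Rational.Unnormalised using (mkℚᵘ; *≡*)
open import Relation.Binary.PropositionalEquality using (_≡_; refl; sym; trans; cong; cong₂; module ≡-Reasoning)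
open import Relation.Nullary using (contradiction)

open ≡-Reasoning

odd⇒≡1+2j : ∀ m → 2 ∤ m → ∃[ j ] m ≡ suc (j * 2)
odd⇒≡1+2j zero          2∤m = contradiction (2 ∣0) 2∤m
odd⇒≡1+2j (suc zero)    2∤m = 0 , refl
odd⇒≡1+2j (suc (suc m)) 2∤m with odd⇒≡1+2j m (λ 2∣m → 2∤m (∣m∣n⇒∣m+n ∣-refl 2∣m))
... | j , refl = suc j , refl

-- Induction on `b`: a unit moves from `b` to `p`, so the induction hypothesis is used at `suc p`.
F-+ : ∀ b p → F (b + suc p) ≡ F (suc b) * F (suc p) + F b * F p
F-+ zero    p = sym (trans (+-identityʳ _) (+-identityʳ _))
F-+ (suc b) p = begin
  F (suc b + suc p)                             ≡⟨ cong F (+-suc b (suc p)) ⟨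
  F (b + suc (suc p))                           ≡⟨ F-+ b (suc p) ⟩
  F (suc b) * (F (suc p) + F p) + F b * F (suc p) ≡⟨ regroup (F (suc b)) (F b) (F (suc p)) (F p) ⟩
  F (suc (suc b)) * F (suc p) + F (suc b) * F p ∎
  where
  regroup : ∀ v u y x → v * (y + x) + u * y ≡ (v + u) * y + v * x
  regroup = solve-∀

-- This is the familiar L_n = F_(n+1) + F_(n-1), expanded so that only `F (suc p)` and `F p`, the
-- two quantities in Cassini's identity, occur.
L-suc : ∀ p → L (suc p) ≡ F (suc p) + 2 * F p
L-suc zero          = refl
L-suc (suc zero)    = refl
L-suc (suc (suc p)) = trans (cong₂ _+_ (L-suc (suc p)) (L-suc p))
  (regroup (F (suc (suc p))) (F (suc p)) (F p))
  where
  regroup : ∀ z y x → z + 2 * y + (y + 2 * x) ≡ z + y + 2 * (y + x)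
  regroup = solve-∀

-- Cassini's identity at an even index, with F (2j + 2) expanded.
cassini-even : ∀ j → let x = F (j * 2); y = F (suc (j * 2)) in
  y * y ≡ x * x + x * y + 1
cassini-even zero    = refl
cassini-even (suc j) = begin
  (y + x + y) * (y + x + y)                               ≡⟨ split x y ⟩
  x * x + 4 * (x * y) + 3 * (y * y) + y * y               ≡⟨ cong (λ s → x * x + 4 * (x * y) + 3 * (y * y) + s) (cassini-even j) ⟩
  x * x + 4 * (x * y) + 3 * (y * y) + (x * x + x * y + 1) ≡⟨ merge x y ⟩
  (y + x) * (y + x) + (y + x) * (y + x + y) + 1           ∎
  where
  x = F (j * 2)
  y = F (suc (j * 2))
  split : ∀ x y → (y + x + y) * (y + x + y) ≡ x * x + 4 * (x * y) + 3 * (y * y) + y * y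
  split = solve-∀
  merge : ∀ x y → x * x + 4 * (x * y) + 3 * (y * y) + (x * x + x * y + 1)
                ≡ (y + x) * (y + x) + (y + x) * (y + x + y) + 1
  merge = solve-∀

-- With m = p + 1, the addition formula turns both sides into polynomials in F b, F (b + 1), F p and
-- F (p + 1). They differ by F b times Cassini's identity, whose sign is the right one because p is
-- even. The term `F b` stands on the left to avoid truncated subtraction.
F*L-odd : ∀ m → 2 ∤ m → ∀ b → F (b + m) * L m + F b ≡ F (b + m + m)
F*L-odd m 2∤m b with odd⇒≡1+2j m 2∤m
... | j , refl = begin
  F (b + suc p) * L (suc p) + u                                ≡⟨ cong₂ (λ s t → s * t + u) (F-+ b p) (L-suc p) ⟩
  (v * y + u * x) * (y + 2 * x) + u                            ≡⟨ split u v x y ⟩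
  -- The lone `u` supplies the 1 in the last factor, which is thereby exactly one side of Cassini's
  -- identity.
  2 * (v * x * y) + v * y * y + u * x * x + u * (x * x + x * y + 1)
    ≡⟨ cong (λ s → 2 * (v * x * y) + v * y * y + u * x * x + u * s) (cassini-even j) ⟨
  2 * (v * x * y) + v * y * y + u * x * x + u * (y * y)        ≡⟨ merge u v x y ⟩
  ((v + u) * y + v * x) * y + (v * y + u * x) * x              ≡⟨ cong₂ (λ s t → s * y + t * x) (F-+ (suc b) p) (F-+ b p) ⟨
  F (suc b + suc p) * y + F (b + suc p) * x                    ≡⟨ F-+ (b + suc p) p ⟨
  F (b + suc p + suc p)                                        ∎
  where
  p = j * 2
  u = F b
  v = F (suc b)
  x = F p
  y = F (suc p)
  split : ∀ u v x y → (v * y + u * x) * (y + 2 * x) + u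
        ≡ 2 * (v * x * y) + v * y * y + u * x * x + u * (x * x + x * y + 1)
  split = solve-∀
  merge : ∀ u v x y → 2 * (v * x * y) + v * y * y + u * x * x + u * (y * y)
        ≡ ((v + u) * y + v * x) * y + (v * y + u * x) * x
  merge = solve-∀

-- `upTo` unfolds from the front, whereas telescoping needs the top term split off.
sum-map-upTo-suc : ∀ (f : ℕ → ℕ) n → sum (map f (upTo (suc n))) ≡ sum (map f (upTo n)) + f n
sum-map-upTo-suc f n = begin
  sum (map f (upTo (suc n)))              ≡⟨ cong (λ ks → sum (map f ks)) (upTo-∷ʳ n) ⟨
  sum (map f (upTo n ∷ʳ n))               ≡⟨ cong sum (map-++ f (upTo n) (n ∷ [])) ⟩
  sum (map f (upTo n) ++ f n ∷ [])        ≡⟨ sum-++ (map f (upTo n)) (f n ∷ []) ⟩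
  sum (map f (upTo n)) + (f n + 0)        ≡⟨ cong (λ t → sum (map f (upTo n)) + t) (+-identityʳ (f n)) ⟩
  sum (map f (upTo n)) + f n              ∎

-- The theorem with its denominator cleared and `n` shifted by one, so that the induction stays in ℕ
-- without subtraction.
sum-F²*L : ∀ m → 2 ∤ m → ∀ n →
  sum (map (λ k → F (m * k) ^ 2) (upTo (suc n))) * L m ≡ F (m * suc n) * F (m * n)
-- Both sides vanish: the only summand is `F (m * 0) ^ 2`, and the right side has the factor
-- `F (m * 0)`.
sum-F²*L m 2∤m zero    rewrite *-zeroʳ m = sym (*-zeroʳ (F (m * 1)))
sum-F²*L m 2∤m (suc n) = begin
  sum (map f (upTo (suc (suc n)))) * L m  ≡⟨ cong (_* L m) (sum-map-upTo-suc f (suc n)) ⟩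
  (S + a ^ 2) * L m                       ≡⟨ *-distribʳ-+ (L m) S (a ^ 2) ⟩
  S * L m + a ^ 2 * L m                   ≡⟨ cong (λ t → t + a ^ 2 * L m) (sum-F²*L m 2∤m n) ⟩
  a * F (m * n) + a ^ 2 * L m             ≡⟨ factor a (F (m * n)) (L m) ⟩
  (a * L m + F (m * n)) * a               ≡⟨ cong (_* a) step ⟩
  F (m * suc (suc n)) * a                 ∎
  where
  f = λ k → F (m * k) ^ 2
  S = sum (map f (upTo (suc n)))
  a = F (m * suc n)
  factor : ∀ a c l → a * c + a * (a * 1) * l ≡ (a * l + c) * a
  factor = solve-∀
  m*suc : ∀ k → m * suc k ≡ m * k + m
  m*suc k = trans (*-suc m k) (+-comm m (m * k))
  step : a * L m + F (m * n) ≡ F (m * suc (suc n))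
  step = begin
    a * L m + F (m * n)               ≡⟨ cong (λ i → F i * L m + F (m * n)) (m*suc n) ⟩
    F (m * n + m) * L m + F (m * n)   ≡⟨ F*L-odd m 2∤m (m * n) ⟩
    F (m * n + m + m)                 ≡⟨ cong (λ i → F (i + m)) (m*suc n) ⟨
    F (m * suc n + m)                 ≡⟨ cong F (m*suc (suc n)) ⟨
    F (m * suc (suc n))               ∎

-- `/` reduces to lowest terms, so the cross-multiplication is done on unnormalised fractions and
-- then transported. `mkℚᵘ` stores the denominator minus one, hence `0` and `d-1`.
*≡⇒/1≡/ : ∀ s t d .{{_ : NonZero d}} → s * d ≡ t → + s / 1 ≡ + t / d
*≡⇒/1≡/ s t d@(suc d-1) s*d≡t = fromℚᵘ-cong {mkℚᵘ (+ s) 0} {mkℚᵘ (+ t) d-1} (*≡* (begin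
  + s ℤ.* + d   ≡⟨ pos-* s d ⟨
  + (s * d)     ≡⟨ cong (λ i → + i) s*d≡t ⟩
  + t           ≡⟨ ℤ-*-identityʳ (+ t) ⟨
  + t ℤ.* + 1   ∎))

proposition3 : ∀ (m : ℕ) → 1 ≤ m → 2 ∤ m → ∀ (n : ℕ) → 1 ≤ n →
    + sum (map (λ k → F (m * k) ^ 2) (upTo n)) / 1 ≡ (+ (F (m * n) * F (m * (n ∸ 1))) / L m) {{L-nonZero m}}
-- Matching on `suc n` makes `n ∸ 1` in the statement compute to the predecessor.
proposition3 m _ 2∤m (suc n) _ =
  *≡⇒/1≡/ (sum (map (λ k → F (m * k) ^ 2) (upTo (suc n)))) (F (m * suc n) * F (m * n))
    (L m) {{L-nonZero m}} (sum-F²*L m 2∤m n)
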